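{- Let $n$ be a non-negative integer and $m$ an integer with $0<n+m\le 2n+1$. Then $$\sum_{k=0}^{n+m}\frac{(-2)^k}{(n+m+k)(n-m+k+2)}\,\frac{\binom{n+m+k}{n+m-k}}{\binom{n-m+k+1}{k}}=\frac{1}{2(n+1)(n+m)}\sum_{k=0}^n(-1)^k\frac{\binom{n+m}{2k}}{\binom nk}.$$ In particular, for $n\ge1$, $$\sum_{k=0}^{n}\frac{(-2)^k}{(n+k)(n+k+1)(n+k+2)}\,\frac{\binom{n+k}{n-k}}{\binom{n+k}{k}}=\frac{1}{2n(n+1)^2}\sum_{k=0}^n(-1)^k\frac{\binom{n}{2k}}{\binom nk},$$ $$\sum_{k=0}^{2n}\frac{(-2)^k}{(2n+k)(k+1)(k+2)}\binom{2n+k}{2n-k}=\frac{1}{4n(n+1)}\sum_{k=0}^n(-1)^k\frac{\binom{2n}{2k}}{\binom nk}.$$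
   Context: Binomial coefficients $\binom{a}{b}$ with integers $0\le a<b$ are $0$. -}

module Defs where

open import Data.Fin using (toℕ)
open import Data.Integer using (ℤ; +_; -[1+_]; +0; +[1+_]; -_; 0ℤ)
open import Data.Nat using (ℕ; suc)
open import Data.Nat.Combinatorics using (_C_)
open import Data.Rational using (ℚ; 0ℚ; _/_)
open import Data.Rational.Properties using (+-0-commutativeMonoid)
open import Algebra.Properties.CommutativeMonoid.Sum +-0-commutativeMonoid using (sum)

-- The library's `a C b` is already 0 when a < b. The clause for negative
-- arguments is a junk value: in the theorem both arguments are always
-- nonnegative (for binom (n - m + k + 1) k this uses n + m ≤ 2n + 1).
binom : ℤ → ℤ → ℤ
binom (+ a) (+ b) = + (a C b)
binom _     _     = 0ℤ

infixl 7 _÷ℤ_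

-- The rational number i / j, made total by i / 0 = 0. Every denominator in
-- the theorem is nonzero under its hypotheses and over the summation range.
_÷ℤ_ : ℤ → ℤ → ℚ
i ÷ℤ +0       = 0ℚ
i ÷ℤ +[1+ d ] = i / suc d
i ÷ℤ -[1+ d ] = (- i) / suc d

-- Both end points 0 and N are included.
sumTo : ℕ → (ℕ → ℚ) → ℚ
sumTo N f = sum {suc N} λ i → f (toℕ i)

infix 10 sumTo

syntax sumTo N (λ k → t) = ∑[ k ≤ N ] t

{-# OPTIONS --safe #-}

-- Write a = n + m and b = n - m + 1, so that a + b = 2n + 1. Both sides, times 2a, are
-- 2 ∫₀¹ x^b T_a(x) dx for the Chebyshev polynomial T_a: the left-hand side expands
-- T_a in powers of 1 - x, the right-hand side uses T_a(x) = Σ_k C(a, 2k) (x² - 1)^k x^(a - 2k),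
-- and each term is a beta integral. Integrals are avoided: both sums inherit from
-- T_{a+2} = 2x T_{a+1} - T_a the recurrence F(a+2, b) = 2 F(a+1, b+1) - F(a, b), where
-- multiplication by x is expressed by B(b, k) = B(b+1, k) + B(b, k+1), and they agree for a = 0, 1.
module Submission where

open import Defs
open import Data.Integer using (ℤ; +_; -_; ∣_∣; _+_; _-_; _*_; _^_; _≤_; _<_)
import Data.Integer.Properties as ℤ
open import Data.Fin using (toℕ)
open import Data.Fin.Properties using (toℕ≤pred[n])
open import Data.Nat as ℕ using (ℕ; zero; suc; _∸_; z≤n; s≤s)
open import Data.Nat.Combinatorics using (_C_; k>n⇒nCk≡0; nCk+nC[k+1]≡[n+1]C[k+1]; nCk≡nC[n∸k]; nC1≡n)
import Data.Nat.Properties as ℕ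
import Data.Integer.Tactic.RingSolver as ℤ-Solver
import Data.Nat.Tactic.RingSolver as ℕ-Solver
open import Data.Product using (_×_; _,_)
open import Data.Rational as ℚ using (ℚ; 0ℚ; 1ℚ)
import Data.Rational.Properties as ℚ
open import Data.Rational.Solver using (module +-*-Solver)
open import Data.Rational.Unnormalised as ℚᵘ using (mkℚᵘ)
import Data.Rational.Unnormalised.Properties as ℚᵘ
open import Relation.Binary.PropositionalEquality
open import Algebra.Properties.Group ℚ.+-0-group using (∙-cancelʳ)
open import Algebra.Properties.CommutativeMonoid.Sum ℚ.+-0-commutativeMonoid using (∑-distrib-+; sum-cong-≗)
open import Algebra.Properties.CommutativeSemigroup ℕ.*-commutativeSemigroup using (x∙yz≈y∙xz)
open +-*-Solver using (solve; _:+_; _:*_; :-_; _:=_; con)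

-- Binomial coefficients: absorption and second differences.

Pascal : ∀ n k → suc n C suc k ≡ n C k ℕ.+ n C suc k
Pascal n k = sym (nCk+nC[k+1]≡[n+1]C[k+1] n k)

-- Induction on both arguments: Pascal's rule splits the left side into two instances for the
-- smaller upper index, and a second use of the rule recombines them.
absorption : ∀ n k → suc k ℕ.* (suc n C suc k) ≡ suc n ℕ.* (n C k)
absorption zero zero = refl
absorption zero (suc k) = begin
  suc (suc k) ℕ.* (1 C suc (suc k)) ≡⟨ cong (suc (suc k) ℕ.*_) (k>n⇒nCk≡0 {1} {suc (suc k)} (s≤s (s≤s z≤n))) ⟩
  suc (suc k) ℕ.* 0                 ≡⟨ ℕ.*-zeroʳ (suc (suc k)) ⟩
  0                                 ≡⟨ cong (1 ℕ.*_) (k>n⇒nCk≡0 {0} {suc k} (s≤s z≤n)) ⟨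
  1 ℕ.* (0 C suc k)                 ∎
  where open ≡-Reasoning
absorption (suc n) zero = begin
  1 ℕ.* (suc (suc n) C 1) ≡⟨ cong (1 ℕ.*_) (nC1≡n (suc (suc n))) ⟩
  1 ℕ.* suc (suc n)       ≡⟨ ℕ.*-comm 1 (suc (suc n)) ⟩
  suc (suc n) ℕ.* 1       ∎
  where open ≡-Reasoning
absorption (suc n) (suc k) = begin
  suc (suc k) ℕ.* (suc (suc n) C suc (suc k))
    ≡⟨ cong (suc (suc k) ℕ.*_) (Pascal (suc n) (suc k)) ⟩
  suc (suc k) ℕ.* (x ℕ.+ (suc n C suc (suc k)))
    ≡⟨ expand (suc k) x _ ⟩
  x ℕ.+ suc k ℕ.* x ℕ.+ suc (suc k) ℕ.* (suc n C suc (suc k))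
    ≡⟨ cong₂ (λ u v → x ℕ.+ u ℕ.+ v) (absorption n k) (absorption n (suc k)) ⟩
  x ℕ.+ suc n ℕ.* (n C k) ℕ.+ suc n ℕ.* (n C suc k)
    ≡⟨ collect x (suc n) (n C k) (n C suc k) ⟩
  x ℕ.+ suc n ℕ.* (n C k ℕ.+ n C suc k)
    ≡⟨ cong (λ u → x ℕ.+ suc n ℕ.* u) (Pascal n k) ⟨
  suc (suc n) ℕ.* x ∎
  where
  open ≡-Reasoning
  x = suc n C suc k
  expand : ∀ k x y → suc k ℕ.* (x ℕ.+ y) ≡ x ℕ.+ k ℕ.* x ℕ.+ suc k ℕ.* y
  expand = ℕ-Solver.solve-∀
  collect : ∀ x n y z → x ℕ.+ n ℕ.* y ℕ.+ n ℕ.* z ≡ x ℕ.+ n ℕ.* (y ℕ.+ z)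
  collect = ℕ-Solver.solve-∀

-- The rule (n + 1 - k) C(n + 1, k) = (n + 1) C(n, k), with the subtracted term moved across to
-- avoid truncated subtraction.
upper-absorption : ∀ n k → suc n ℕ.* (n C k) ℕ.+ k ℕ.* (suc n C k) ≡ suc n ℕ.* (suc n C k)
upper-absorption n zero = ℕ.+-identityʳ _
upper-absorption n (suc k) = begin
  suc n ℕ.* (n C suc k) ℕ.+ suc k ℕ.* (suc n C suc k) ≡⟨ cong (suc n ℕ.* (n C suc k) ℕ.+_) (absorption n k) ⟩
  suc n ℕ.* (n C suc k) ℕ.+ suc n ℕ.* (n C k)         ≡⟨ collect (suc n) (n C suc k) (n C k) ⟩
  suc n ℕ.* (n C k ℕ.+ n C suc k)                     ≡⟨ cong (suc n ℕ.*_) (Pascal n k) ⟨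
  suc n ℕ.* (suc n C suc k)                           ∎
  where
  open ≡-Reasoning
  collect : ∀ n y z → n ℕ.* y ℕ.+ n ℕ.* z ≡ n ℕ.* (z ℕ.+ y)
  collect = ℕ-Solver.solve-∀

symmetric : ∀ m n → (m ℕ.+ n) C n ≡ (m ℕ.+ n) C m
symmetric m n = trans (nCk≡nC[n∸k] (ℕ.m≤n+m n m)) (cong ((m ℕ.+ n) C_) (ℕ.m+n∸n≡m m n))

-- Compare coefficients in (1 + x)^n ((1 + x)² - 2(1 + x) + 1) = (1 + x)^n x², again without
-- subtraction.
second-difference : ∀ n k →
  suc (suc n) C suc (suc k) ℕ.+ n C suc (suc k) ≡ 2 ℕ.* (suc n C suc (suc k)) ℕ.+ n C k
second-difference n k
  rewrite Pascal (suc n) (suc k) | Pascal n (suc k) | Pascal n k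
  = rearrange (n C k) (n C suc k) (n C suc (suc k))
  where
  rearrange : ∀ x y z → x ℕ.+ y ℕ.+ (y ℕ.+ z) ℕ.+ z ≡ 2 ℕ.* (y ℕ.+ z) ℕ.+ x
  rearrange = ℕ-Solver.solve-∀

second-difference-even : ∀ n k →
  suc (suc n) C (2 ℕ.* suc k) ℕ.+ n C (2 ℕ.* suc k) ≡ 2 ℕ.* (suc n C (2 ℕ.* suc k)) ℕ.+ n C (2 ℕ.* k)
second-difference-even n k =
  subst (λ j → suc (suc n) C j ℕ.+ n C j ≡ 2 ℕ.* (suc n C j) ℕ.+ n C (2 ℕ.* k))
    (sym (ℕ.*-suc 2 k)) (second-difference n (2 ℕ.* k))

-- Coefficients of Chebyshev polynomials in powers of 1 - x.

-- The Chebyshev polynomial of the first kind is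
-- 2 T_a(x) = Σ_k (-2)^k · chebyshev a k · (1 - x)^k.
chebyshev : ℕ → ℕ → ℕ
chebyshev a k = (a ℕ.+ k) C (2 ℕ.* k) ℕ.+ (a ℕ.+ k ∸ 1) C (2 ℕ.* k)

-- The coefficient of (1 - x)^(k + 1) in T_{a+2} + T_a = 2x T_{a+1}, with 2x = 2 - 2(1 - x) and the
-- common factor (-2)^(k + 1) removed. Each of the two binomials in `chebyshev` satisfies it
-- separately, as a second difference.
chebyshev-recurrence : ∀ a k →
  chebyshev (suc (suc a)) (suc k) ℕ.+ chebyshev a (suc k)
    ≡ 2 ℕ.* chebyshev (suc a) (suc k) ℕ.+ chebyshev (suc a) k
chebyshev-recurrence a k rewrite ℕ.+-suc a k = begin
  x₃ ℕ.+ x₂ ℕ.+ (x₁ ℕ.+ x₀)             ≡⟨ regroup x₃ x₂ x₁ x₀ ⟩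
  (x₃ ℕ.+ x₁) ℕ.+ (x₂ ℕ.+ x₀)           ≡⟨ cong₂ ℕ._+_ (second-difference-even (suc (a ℕ.+ k)) k) (second-difference-even (a ℕ.+ k) k) ⟩
  (2 ℕ.* x₂ ℕ.+ y₁) ℕ.+ (2 ℕ.* x₁ ℕ.+ y₀) ≡⟨ regroup′ x₂ y₁ x₁ y₀ ⟩
  2 ℕ.* (x₂ ℕ.+ x₁) ℕ.+ (y₁ ℕ.+ y₀)     ∎
  where
  open ≡-Reasoning
  x₀ = (a ℕ.+ k) C (2 ℕ.* suc k)
  x₁ = suc (a ℕ.+ k) C (2 ℕ.* suc k)
  x₂ = suc (suc (a ℕ.+ k)) C (2 ℕ.* suc k)
  x₃ = suc (suc (suc (a ℕ.+ k))) C (2 ℕ.* suc k)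
  y₀ = (a ℕ.+ k) C (2 ℕ.* k)
  y₁ = suc (a ℕ.+ k) C (2 ℕ.* k)
  regroup : ∀ p q r s → p ℕ.+ q ℕ.+ (r ℕ.+ s) ≡ (p ℕ.+ r) ℕ.+ (q ℕ.+ s)
  regroup = ℕ-Solver.solve-∀
  regroup′ : ∀ p q r s → (2 ℕ.* p ℕ.+ q) ℕ.+ (2 ℕ.* r ℕ.+ s) ≡ 2 ℕ.* (p ℕ.+ r) ℕ.+ (q ℕ.+ s)
  regroup′ = ℕ-Solver.solve-∀

-- T_a has degree a. This lets sums of different lengths be brought to a common length.
chebyshev-vanishes : ∀ {a k} → a ℕ.< k → chebyshev a k ≡ 0
chebyshev-vanishes {a} {k} a<k =
  cong₂ ℕ._+_ (k>n⇒nCk≡0 a+k<2k) (k>n⇒nCk≡0 (ℕ.≤-<-trans (ℕ.m∸n≤m (a ℕ.+ k) 1) a+k<2k))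
  where
  a+k<2k : a ℕ.+ k ℕ.< 2 ℕ.* k
  a+k<2k = subst (a ℕ.+ k ℕ.<_) (cong (k ℕ.+_) (sym (ℕ.+-identityʳ k))) (ℕ.+-monoˡ-< k a<k)

-- Links the two-term coefficient, which suits the recurrence, to the single binomial over n + m + k
-- in the theorem. It follows from `upper-absorption` after adding `2 * k * x` to both sides.
chebyshev-closed : ∀ a k → (suc a ℕ.+ k) ℕ.* chebyshev (suc a) k ≡ 2 ℕ.* suc a ℕ.* ((suc a ℕ.+ k) C (2 ℕ.* k))
chebyshev-closed a k = ℕ.+-cancelʳ-≡ (2 ℕ.* k ℕ.* x) _ _ (begin
  n ℕ.* (x ℕ.+ y) ℕ.+ 2 ℕ.* k ℕ.* x                 ≡⟨ regroup n x y (2 ℕ.* k) ⟩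
  n ℕ.* x ℕ.+ (n ℕ.* y ℕ.+ 2 ℕ.* k ℕ.* x)           ≡⟨ cong (n ℕ.* x ℕ.+_) (upper-absorption (a ℕ.+ k) (2 ℕ.* k)) ⟩
  n ℕ.* x ℕ.+ n ℕ.* x                               ≡⟨ expand (suc a) k x ⟩
  2 ℕ.* suc a ℕ.* x ℕ.+ 2 ℕ.* k ℕ.* x               ∎)
  where
  open ≡-Reasoning
  n = suc a ℕ.+ k
  x = n C (2 ℕ.* k)
  y = (a ℕ.+ k) C (2 ℕ.* k)
  regroup : ∀ n x y z → n ℕ.* (x ℕ.+ y) ℕ.+ z ℕ.* x ≡ n ℕ.* x ℕ.+ (n ℕ.* y ℕ.+ z ℕ.* x)
  regroup = ℕ-Solver.solve-∀
  expand : ∀ a k x → (a ℕ.+ k) ℕ.* x ℕ.+ (a ℕ.+ k) ℕ.* x ≡ 2 ℕ.* a ℕ.* x ℕ.+ 2 ℕ.* k ℕ.* x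
  expand = ℕ-Solver.solve-∀

-- Fractions as products of integers and reciprocals.

-- A zero denominator makes both sides `0ℚ`, by the convention for `_÷ℤ_`. Otherwise the product is
-- formed on unnormalised fractions, numerators and denominators separately.
÷-* : ∀ i j m n → (i ÷ℤ + m) ℚ.* (j ÷ℤ + n) ≡ (i * j) ÷ℤ + (m ℕ.* n)
÷-* i j zero n = ℚ.*-zeroˡ (j ÷ℤ + n)
÷-* i j (suc m) zero rewrite ℕ.*-zeroʳ m = ℚ.*-zeroʳ (i ÷ℤ + suc m)
÷-* i j (suc m) (suc n) = ℚ.toℚᵘ-injective (begin
  ℚ.toℚᵘ (p ℚ.* q)              ≈⟨ ℚ.toℚᵘ-homo-* p q ⟩
  ℚ.toℚᵘ p ℚᵘ.* ℚ.toℚᵘ q        ≈⟨ ℚᵘ.*-cong (ℚ.toℚᵘ-fromℚᵘ (mkℚᵘ i m)) (ℚ.toℚᵘ-fromℚᵘ (mkℚᵘ j n)) ⟩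
  mkℚᵘ i m ℚᵘ.* mkℚᵘ j n        ≈⟨ ℚ.toℚᵘ-fromℚᵘ (mkℚᵘ i m ℚᵘ.* mkℚᵘ j n) ⟨
  ℚ.toℚᵘ ((i * j) ÷ℤ + (suc m ℕ.* suc n)) ∎)
  where
  open ℚᵘ.≃-Reasoning
  p = i ÷ℤ + suc m
  q = j ÷ℤ + suc n

-- Opaque, since conversion checking would otherwise unfold the gcd computations of _/_.
opaque
  ι : ℤ → ℚ
  ι i = i ÷ℤ + 1

  ρ : ℕ → ℚ
  ρ n = + 1 ÷ℤ + n

ν : ℕ → ℚ
ν n = ι (+ n)

opaque
  unfolding ι ρ

  -- Puts fractions into a form in which the ring solver can treat numerators and reciprocals as
  -- variables.
  ÷-split : ∀ i n → i ÷ℤ + n ≡ ι i ℚ.* ρ n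
  ÷-split i n = sym (trans (÷-* i (+ 1) 1 n) (cong₂ (λ j m → j ÷ℤ + m) (ℤ.*-identityʳ i) (ℕ.+-identityʳ n)))

  ι-* : ∀ i j → ι (i * j) ≡ ι i ℚ.* ι j
  ι-* i j = sym (÷-* i j 1 1)

  ι-÷ : ∀ i → i ÷ℤ + 1 ≡ ι i
  ι-÷ i = refl

  ρ-÷ : ∀ n → + 1 ÷ℤ + n ≡ ρ n
  ρ-÷ n = refl

  ν-0 : ν 0 ≡ 0ℚ
  ν-0 = refl

  ν-1 : ν 1 ≡ 1ℚ
  ν-1 = refl

  ι-minus-2 : ι (- (+ 2)) ≡ ℚ.- (1ℚ ℚ.+ 1ℚ)
  ι-minus-2 = refl

  ι-minus-1 : ι (- (+ 1)) ≡ ℚ.- 1ℚ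
  ι-minus-1 = refl

  ν-* : ∀ m n → ν (m ℕ.* n) ≡ ν m ℚ.* ν n
  ν-* m n = trans (cong ι (ℤ.pos-* m n)) (ι-* (+ m) (+ n))

  ρ-* : ∀ m n → ρ (m ℕ.* n) ≡ ρ m ℚ.* ρ n
  ρ-* m n = sym (÷-* (+ 1) (+ 1) m n)

  ν-+ : ∀ m n → ν (m ℕ.+ n) ≡ ν m ℚ.+ ν n
  ν-+ m n = ℚ.toℚᵘ-injective (begin
    ℚ.toℚᵘ (ν (m ℕ.+ n))                ≈⟨ ℚ.toℚᵘ-fromℚᵘ (mkℚᵘ (+ (m ℕ.+ n)) 0) ⟩
    mkℚᵘ (+ (m ℕ.+ n)) 0                ≡⟨ cong (λ i → mkℚᵘ i 0) (cong₂ _+_ (ℤ.*-identityʳ (+ m)) (ℤ.*-identityʳ (+ n))) ⟨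
    mkℚᵘ (+ m) 0 ℚᵘ.+ mkℚᵘ (+ n) 0      ≈⟨ ℚᵘ.+-cong (ℚ.toℚᵘ-fromℚᵘ (mkℚᵘ (+ m) 0)) (ℚ.toℚᵘ-fromℚᵘ (mkℚᵘ (+ n) 0)) ⟨
    ℚ.toℚᵘ (ν m) ℚᵘ.+ ℚ.toℚᵘ (ν n)      ≈⟨ ℚ.toℚᵘ-homo-+ (ν m) (ν n) ⟨
    ℚ.toℚᵘ (ν m ℚ.+ ν n)                ∎)
    where open ℚᵘ.≃-Reasoning

ι-*-minus-1 : ∀ i → ι (- (+ 1) * i) ≡ ℚ.- ι i
ι-*-minus-1 i = begin
  ι (- (+ 1) * i)        ≡⟨ ι-* (- (+ 1)) i ⟩
  ι (- (+ 1)) ℚ.* ι i    ≡⟨ cong (ℚ._* ι i) ι-minus-1 ⟩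
  ℚ.- 1ℚ ℚ.* ι i         ≡⟨ solve 1 (λ x → :- con 1ℚ :* x := :- x) refl (ι i) ⟩
  ℚ.- ι i                ∎
  where open ≡-Reasoning

ι-*-minus-2 : ∀ i → ι (- (+ 2) * i) ≡ ℚ.- (ι i ℚ.+ ι i)
ι-*-minus-2 i = begin
  ι (- (+ 2) * i)            ≡⟨ ι-* (- (+ 2)) i ⟩
  ι (- (+ 2)) ℚ.* ι i        ≡⟨ cong (ℚ._* ι i) ι-minus-2 ⟩
  ℚ.- (1ℚ ℚ.+ 1ℚ) ℚ.* ι i    ≡⟨ solve 1 (λ x → :- (con 1ℚ :+ con 1ℚ) :* x := :- (x :+ x)) refl (ι i) ⟩
  ℚ.- (ι i ℚ.+ ι i)          ∎
  where open ≡-Reasoning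

ν-double : ∀ n → ν (2 ℕ.* n) ≡ ν n ℚ.+ ν n
ν-double n = trans (cong ν (cong (n ℕ.+_) (ℕ.+-identityʳ n))) (ν-+ n n)

opaque
  unfolding ι ρ

  ν-ρ : ∀ n → ν (suc n) ℚ.* ρ (suc n) ≡ 1ℚ
  ν-ρ n = trans (sym (÷-split (+ suc n) (suc n))) (ℚ.fromℚᵘ-cong {mkℚᵘ (+ suc n) n} {mkℚᵘ (+ 1) 0} (ℚᵘ.*≡* (ℤ.*-comm (+ suc n) (+ 1))))

ν-cancelˡ : ∀ n {x y} → ν (suc n) ℚ.* x ≡ ν (suc n) ℚ.* y → x ≡ y
ν-cancelˡ n {x} {y} eq = begin
  x                                     ≡⟨ insert x ⟩
  ρ (suc n) ℚ.* (ν (suc n) ℚ.* x)       ≡⟨ cong (ρ (suc n) ℚ.*_) eq ⟩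
  ρ (suc n) ℚ.* (ν (suc n) ℚ.* y)       ≡⟨ insert y ⟨
  y                                     ∎
  where
  open ≡-Reasoning
  insert : ∀ x → x ≡ ρ (suc n) ℚ.* (ν (suc n) ℚ.* x)
  insert x = begin
    x                                   ≡⟨ ℚ.*-identityˡ x ⟨
    1ℚ ℚ.* x                            ≡⟨ cong (ℚ._* x) (trans (ℚ.*-comm (ρ (suc n)) _) (ν-ρ n)) ⟨
    ρ (suc n) ℚ.* ν (suc n) ℚ.* x       ≡⟨ ℚ.*-assoc (ρ (suc n)) _ x ⟩
    ρ (suc n) ℚ.* (ν (suc n) ℚ.* x)     ∎

-- Turns a proportion between denominators into one between reciprocals: `suc d` is cancelled
-- against its inverse, and the rest is multiplicativity of `ρ`.
ρ-shift : ∀ d p s q → suc d ℕ.* p ≡ s ℕ.* q → ρ p ≡ ν (suc d) ℚ.* (ρ s ℚ.* ρ q)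
ρ-shift d p s q eq = begin
  ρ p                                        ≡⟨ ℚ.*-identityˡ (ρ p) ⟨
  1ℚ ℚ.* ρ p                                 ≡⟨ cong (ℚ._* ρ p) (ν-ρ d) ⟨
  ν (suc d) ℚ.* ρ (suc d) ℚ.* ρ p            ≡⟨ ℚ.*-assoc (ν (suc d)) _ _ ⟩
  ν (suc d) ℚ.* (ρ (suc d) ℚ.* ρ p)          ≡⟨ cong (ν (suc d) ℚ.*_) (trans (sym (ρ-* (suc d) p)) (trans (cong ρ eq) (ρ-* s q))) ⟩
  ν (suc d) ℚ.* (ρ s ℚ.* ρ q)                ∎
  where open ≡-Reasoning

-- Beta integrals.

-- The reciprocal of b! k! / (b + k + 1)!, the Euler integral B(b + 1, k + 1).
betaDen : ℕ → ℕ → ℕ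
betaDen b k = suc (b ℕ.+ k) ℕ.* ((b ℕ.+ k) C k)

-- ∫₀¹ x^b (1 - x)^k dx
beta : ℕ → ℕ → ℚ
beta b k = ρ (betaDen b k)

-- Symmetry moves the lower index from `k` to `suc b`, where `absorption` applies.
betaDen-sucˡ : ∀ b k → suc b ℕ.* betaDen (suc b) k ≡ suc (suc b ℕ.+ k) ℕ.* betaDen b k
betaDen-sucˡ b k = begin
  suc b ℕ.* (s ℕ.* (suc (b ℕ.+ k) C k))      ≡⟨ cong (λ x → suc b ℕ.* (s ℕ.* x)) (symmetric (suc b) k) ⟩
  suc b ℕ.* (s ℕ.* (suc (b ℕ.+ k) C suc b))  ≡⟨ x∙yz≈y∙xz (suc b) s (suc (b ℕ.+ k) C suc b) ⟩
  s ℕ.* (suc b ℕ.* (suc (b ℕ.+ k) C suc b))  ≡⟨ cong (s ℕ.*_) (absorption (b ℕ.+ k) b) ⟩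
  s ℕ.* (suc (b ℕ.+ k) ℕ.* ((b ℕ.+ k) C b))  ≡⟨ cong (λ x → s ℕ.* (suc (b ℕ.+ k) ℕ.* x)) (symmetric b k) ⟨
  s ℕ.* betaDen b k                          ∎
  where
  open ≡-Reasoning
  s = suc (suc b ℕ.+ k)

betaDen-sucʳ : ∀ b k → suc k ℕ.* betaDen b (suc k) ≡ suc (suc b ℕ.+ k) ℕ.* betaDen b k
betaDen-sucʳ b k rewrite ℕ.+-suc b k = begin
  suc k ℕ.* (s ℕ.* (suc (b ℕ.+ k) C suc k))  ≡⟨ x∙yz≈y∙xz (suc k) s (suc (b ℕ.+ k) C suc k) ⟩
  s ℕ.* (suc k ℕ.* (suc (b ℕ.+ k) C suc k))  ≡⟨ cong (s ℕ.*_) (absorption (b ℕ.+ k) k) ⟩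
  s ℕ.* betaDen b k                          ∎
  where
  open ≡-Reasoning
  s = suc (suc b ℕ.+ k)

-- Integrated form of 1 = x + (1 - x). Both parts are multiples of `beta b k`, by (b + 1)/(b + k +
-- 2) and (k + 1)/(b + k + 2), and these factors add up to 1.
beta-split : ∀ b k → beta b k ≡ beta (suc b) k ℚ.+ beta b (suc k)
beta-split b k = sym (begin
  beta (suc b) k ℚ.+ beta b (suc k)
    ≡⟨ cong₂ ℚ._+_ (ρ-shift b (betaDen (suc b) k) s (betaDen b k) (betaDen-sucˡ b k)) (ρ-shift k (betaDen b (suc k)) s (betaDen b k) (betaDen-sucʳ b k)) ⟩
  ν (suc b) ℚ.* (ρ s ℚ.* β) ℚ.+ ν (suc k) ℚ.* (ρ s ℚ.* β)
    ≡⟨ ℚ.*-distribʳ-+ (ρ s ℚ.* β) (ν (suc b)) (ν (suc k)) ⟨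
  (ν (suc b) ℚ.+ ν (suc k)) ℚ.* (ρ s ℚ.* β)
    ≡⟨ cong (ℚ._* (ρ s ℚ.* β)) (trans (sym (ν-+ (suc b) (suc k))) (cong (λ x → ν (suc x)) (ℕ.+-suc b k))) ⟩
  ν s ℚ.* (ρ s ℚ.* β)
    ≡⟨ ℚ.*-assoc (ν s) (ρ s) β ⟨
  ν s ℚ.* ρ s ℚ.* β
    ≡⟨ cong (ℚ._* β) (ν-ρ (suc b ℕ.+ k)) ⟩
  1ℚ ℚ.* β
    ≡⟨ ℚ.*-identityˡ β ⟩
  β ∎)
  where
  open ≡-Reasoning
  s = suc (suc b ℕ.+ k)
  β = beta b k

-- Finite sums and termwise recurrences.

sumTo-cong : ∀ N {f g : ℕ → ℚ} → (∀ k → k ℕ.≤ N → f k ≡ g k) → sumTo N f ≡ sumTo N g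
sumTo-cong N eq = sum-cong-≗ {suc N} (λ i → eq _ (toℕ≤pred[n] i))

sumTo-+ : ∀ N (f g : ℕ → ℚ) → sumTo N (λ k → f k ℚ.+ g k) ≡ sumTo N f ℚ.+ sumTo N g
sumTo-+ N f g = ∑-distrib-+ {suc N} (λ i → f (toℕ i)) (λ i → g (toℕ i))

sumTo-* : ∀ N c (f : ℕ → ℚ) → sumTo N (λ k → c ℚ.* f k) ≡ c ℚ.* sumTo N f
sumTo-* zero c f = sym (trans (ℚ.*-distribˡ-+ c (f 0) 0ℚ) (cong (c ℚ.* f 0 ℚ.+_) (ℚ.*-zeroʳ c)))
sumTo-* (suc N) c f =
  trans (cong (c ℚ.* f 0 ℚ.+_) (sumTo-* N c (λ k → f (suc k)))) (sym (ℚ.*-distribˡ-+ c (f 0) _))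

sumTo-last : ∀ N (f : ℕ → ℚ) → sumTo (suc N) f ≡ sumTo N f ℚ.+ f (suc N)
sumTo-last zero f = solve 3 (λ x y o → x :+ (y :+ o) := x :+ o :+ y) refl (f 0) (f 1) 0ℚ
sumTo-last (suc N) f =
  trans (cong (f 0 ℚ.+_) (sumTo-last N (λ k → f (suc k)))) (sym (ℚ.+-assoc (f 0) _ _))

sumTo-drop : ∀ N (f : ℕ → ℚ) → f (suc N) ≡ 0ℚ → sumTo (suc N) f ≡ sumTo N f
sumTo-drop N f eq = trans (sumTo-last N f) (trans (cong (sumTo N f ℚ.+_) eq) (ℚ.+-identityʳ _))

-- Sums a coefficient recurrence in which `z` comes from the preceding index, as happens on
-- multiplying by 1 - x or by x² - 1. Index 0 receives no such contribution.
sumTo-shift : ∀ N (x u y z : ℕ → ℚ) → x 0 ℚ.+ u 0 ≡ y 0 →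
  (∀ k → x (suc k) ℚ.+ u (suc k) ≡ y (suc k) ℚ.+ z k) →
  sumTo (suc N) x ℚ.+ sumTo (suc N) u ≡ sumTo (suc N) y ℚ.+ sumTo N z
sumTo-shift N x u y z eq₀ eq = begin
  sumTo (suc N) x ℚ.+ sumTo (suc N) u                         ≡⟨ sumTo-+ (suc N) x u ⟨
  x 0 ℚ.+ u 0 ℚ.+ sumTo N (λ k → x (suc k) ℚ.+ u (suc k))     ≡⟨ cong₂ ℚ._+_ eq₀ (sumTo-cong N (λ k _ → eq k)) ⟩
  y 0 ℚ.+ sumTo N (λ k → y (suc k) ℚ.+ z k)                   ≡⟨ cong (y 0 ℚ.+_) (sumTo-+ N (λ k → y (suc k)) z) ⟩
  y 0 ℚ.+ (sumTo N (λ k → y (suc k)) ℚ.+ sumTo N z)           ≡⟨ ℚ.+-assoc (y 0) _ _ ⟨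
  sumTo (suc N) y ℚ.+ sumTo N z                               ∎
  where open ≡-Reasoning

-- Carries `chebyshev-recurrence` and `second-difference-even` over to summands that share a power
-- `p` and a beta value `β`.
linear-recurrence : ∀ p β x y v w → x ℕ.+ y ≡ 2 ℕ.* v ℕ.+ w →
  p ℚ.* ν x ℚ.* β ℚ.+ p ℚ.* ν y ℚ.* β
    ≡ p ℚ.* ν v ℚ.* β ℚ.+ p ℚ.* ν v ℚ.* β ℚ.+ p ℚ.* ν w ℚ.* β
linear-recurrence p β x y v w eq = begin
  p ℚ.* ν x ℚ.* β ℚ.+ p ℚ.* ν y ℚ.* β
    ≡⟨ solve 4 (λ p β x y → p :* x :* β :+ p :* y :* β := p :* (x :+ y) :* β) refl p β (ν x) (ν y) ⟩
  p ℚ.* (ν x ℚ.+ ν y) ℚ.* β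
    ≡⟨ cong (λ s → p ℚ.* s ℚ.* β) (trans (sym (ν-+ x y)) (trans (cong ν eq)
         (trans (ν-+ (2 ℕ.* v) w) (cong (ℚ._+ ν w) (ν-double v))))) ⟩
  p ℚ.* (ν v ℚ.+ ν v ℚ.+ ν w) ℚ.* β
    ≡⟨ solve 4 (λ p β v w → p :* (v :+ v :+ w) :* β := p :* v :* β :+ p :* v :* β :+ p :* w :* β) refl p β (ν v) (ν w) ⟩
  p ℚ.* ν v ℚ.* β ℚ.+ p ℚ.* ν v ℚ.* β ℚ.+ p ℚ.* ν w ℚ.* β ∎
  where open ≡-Reasoning

-- The moment expanded in powers of 1 - x.

chebyshevTerm : ℕ → ℕ → ℕ → ℚ
chebyshevTerm a b k = ι ((- (+ 2)) ^ k) ℚ.* ν (chebyshev a k) ℚ.* beta b k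

-- 2 ∫₀¹ x^b T_a(x) dx, expanded in powers of 1 - x
moment : ℕ → ℕ → ℚ
moment a b = sumTo a (chebyshevTerm a b)

chebyshevTerm-vanishes : ∀ {a k} b → a ℕ.< k → chebyshevTerm a b k ≡ 0ℚ
chebyshevTerm-vanishes {a} {k} b a<k = begin
  p ℚ.* ν (chebyshev a k) ℚ.* beta b k ≡⟨ cong (λ e → p ℚ.* ν e ℚ.* beta b k) (chebyshev-vanishes a<k) ⟩
  p ℚ.* ν 0 ℚ.* beta b k               ≡⟨ cong (λ x → p ℚ.* x ℚ.* beta b k) ν-0 ⟩
  p ℚ.* 0ℚ ℚ.* beta b k                ≡⟨ cong (ℚ._* beta b k) (ℚ.*-zeroʳ p) ⟩
  0ℚ ℚ.* beta b k                      ≡⟨ ℚ.*-zeroˡ (beta b k) ⟩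
  0ℚ                                   ∎
  where
  open ≡-Reasoning
  p = ι ((- (+ 2)) ^ k)

-- Integrates x^b (T_{a+2} + T_a) = 2 x^(b+1) T_{a+1}. All sums are first extended to 2 + a by
-- vanishing terms. The sum of `z` is the part -2(1 - x) T_{a+1} of 2x T_{a+1}.
moment-recurrence : ∀ a b →
  moment (suc (suc a)) b ℚ.+ moment a b ≡ moment (suc a) (suc b) ℚ.+ moment (suc a) (suc b)
moment-recurrence a b = begin
  moment (2 ℕ.+ a) b ℚ.+ moment a b
    ≡⟨ cong (moment (2 ℕ.+ a) b ℚ.+_) (trans (sumTo-drop (suc a) u (chebyshevTerm-vanishes b (s≤s (ℕ.n≤1+n a))))
         (sumTo-drop a u (chebyshevTerm-vanishes b ℕ.≤-refl))) ⟨
  sumTo (2 ℕ.+ a) (chebyshevTerm (2 ℕ.+ a) b) ℚ.+ sumTo (2 ℕ.+ a) u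
    -- At index 0 every `chebyshev` coefficient computes to 2, so the initial equation is `refl`.
    ≡⟨ sumTo-shift (suc a) (chebyshevTerm (2 ℕ.+ a) b) u (λ k → t k ℚ.+ t k) z
         refl step ⟩
  sumTo (2 ℕ.+ a) (λ k → t k ℚ.+ t k) ℚ.+ sumTo (suc a) z
    ≡⟨ cong (ℚ._+ sumTo (suc a) z) (sumTo-drop (suc a) (λ k → t k ℚ.+ t k)
         (cong₂ ℚ._+_ t-last t-last)) ⟩
  sumTo (suc a) (λ k → t k ℚ.+ t k) ℚ.+ sumTo (suc a) z
    ≡⟨ sumTo-+ (suc a) (λ k → t k ℚ.+ t k) z ⟨
  sumTo (suc a) (λ k → t k ℚ.+ t k ℚ.+ z k)
    ≡⟨ sumTo-cong (suc a) (λ k _ → combine k) ⟩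
  sumTo (suc a) (λ k → chebyshevTerm (suc a) (suc b) k ℚ.+ chebyshevTerm (suc a) (suc b) k)
    ≡⟨ sumTo-+ (suc a) (chebyshevTerm (suc a) (suc b)) (chebyshevTerm (suc a) (suc b)) ⟩
  moment (suc a) (suc b) ℚ.+ moment (suc a) (suc b) ∎
  where
  open ≡-Reasoning
  u t z : ℕ → ℚ
  u = chebyshevTerm a b
  t = chebyshevTerm (suc a) b
  z k = ι ((- (+ 2)) ^ suc k) ℚ.* ν (chebyshev (suc a) k) ℚ.* beta b (suc k)

  t-last : t (2 ℕ.+ a) ≡ 0ℚ
  t-last = chebyshevTerm-vanishes b ℕ.≤-refl

  step : ∀ k → chebyshevTerm (2 ℕ.+ a) b (suc k) ℚ.+ u (suc k) ≡ t (suc k) ℚ.+ t (suc k) ℚ.+ z k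
  step k = linear-recurrence (ι ((- (+ 2)) ^ suc k)) (beta b (suc k))
    (chebyshev (2 ℕ.+ a) (suc k)) (chebyshev a (suc k)) (chebyshev (suc a) (suc k)) (chebyshev (suc a) k)
    (chebyshev-recurrence a k)

  combine : ∀ k → t k ℚ.+ t k ℚ.+ z k ≡ chebyshevTerm (suc a) (suc b) k ℚ.+ chebyshevTerm (suc a) (suc b) k
  combine k = begin
    -- Splitting `beta b k` produces two copies of the `β′` term, which `z` cancels because its
    -- power carries one more factor -2.
    p ℚ.* v ℚ.* beta b k ℚ.+ p ℚ.* v ℚ.* beta b k ℚ.+ ι ((- (+ 2)) ^ suc k) ℚ.* v ℚ.* β′
      ≡⟨ cong₂ (λ x y → p ℚ.* v ℚ.* x ℚ.+ p ℚ.* v ℚ.* x ℚ.+ y ℚ.* v ℚ.* β′) (beta-split b k) (ι-*-minus-2 ((- (+ 2)) ^ k)) ⟩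
    p ℚ.* v ℚ.* (β ℚ.+ β′) ℚ.+ p ℚ.* v ℚ.* (β ℚ.+ β′) ℚ.+ ℚ.- (p ℚ.+ p) ℚ.* v ℚ.* β′
      ≡⟨ solve 4 (λ p v β β′ → p :* v :* (β :+ β′) :+ p :* v :* (β :+ β′) :+ :- (p :+ p) :* v :* β′
                            := p :* v :* β :+ p :* v :* β) refl p v β β′ ⟩
    p ℚ.* v ℚ.* β ℚ.+ p ℚ.* v ℚ.* β ∎
    where
    p = ι ((- (+ 2)) ^ k)
    v = ν (chebyshev (suc a) k)
    β = beta (suc b) k
    β′ = beta b (suc k)

-- The moment expanded in powers of x² - 1.

-- When a + b = 2n + 1, the integrand 2 x^b x^(a - 2k) (x² - 1)^k dx becomes y^(n - k) (y - 1)^k dy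
-- under y = x², so `b` enters only through `n`.
alternatingTerm : ℕ → ℕ → ℕ → ℚ
alternatingTerm n a k = ι ((- (+ 1)) ^ k) ℚ.* ν (a C (2 ℕ.* k)) ℚ.* beta (n ∸ k) k

-- The same moment for a + b = 2n + 1, from T_a(x) = Σ_k C(a, 2k) (x² - 1)^k x^(a - 2k)
-- and the substitution x² ↦ x.
alternatingSum : ℕ → ℕ → ℚ
alternatingSum n a = sumTo n (alternatingTerm n a)

-- The binomial recurrence naturally involves x² T_a, whose terms are `u`, rather than T_a. Writing
-- x² = 1 + (x² - 1) gives `u` as `alternatingTerm n a` plus `z`, so the sum of `z` is added to both
-- sides and cancelled. The bound on `a` makes the top term of `u` vanish.
alternatingSum-recurrence : ∀ n a → a ℕ.≤ suc (2 ℕ.* n) →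
  alternatingSum (suc n) (suc (suc a)) ℚ.+ alternatingSum n a
    ≡ alternatingSum (suc n) (suc a) ℚ.+ alternatingSum (suc n) (suc a)
alternatingSum-recurrence n a a≤2n+1 = ∙-cancelʳ (sumTo n z) _ _ (begin
  X ℚ.+ alternatingSum n a ℚ.+ sumTo n z
    ≡⟨ ℚ.+-assoc X _ _ ⟩
  X ℚ.+ (alternatingSum n a ℚ.+ sumTo n z)
    ≡⟨ cong (X ℚ.+_) (trans (sym (sumTo-+ n (alternatingTerm n a) z)) (sumTo-cong n combine)) ⟩
  X ℚ.+ sumTo n u
    ≡⟨ cong (X ℚ.+_) (sumTo-drop n u u-last) ⟨
  X ℚ.+ sumTo (suc n) u
    ≡⟨ sumTo-shift n (alternatingTerm (suc n) (2 ℕ.+ a)) u (λ k → t k ℚ.+ t k) z refl step ⟩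
  sumTo (suc n) (λ k → t k ℚ.+ t k) ℚ.+ sumTo n z
    ≡⟨ cong (ℚ._+ sumTo n z) (sumTo-+ (suc n) t t) ⟩
  alternatingSum (suc n) (suc a) ℚ.+ alternatingSum (suc n) (suc a) ℚ.+ sumTo n z ∎)
  where
  open ≡-Reasoning
  X = alternatingSum (suc n) (2 ℕ.+ a)
  u t z : ℕ → ℚ
  u = alternatingTerm (suc n) a
  t = alternatingTerm (suc n) (suc a)
  z k = ι ((- (+ 1)) ^ suc k) ℚ.* ν (a C (2 ℕ.* k)) ℚ.* beta (n ∸ k) (suc k)

  u-last : u (suc n) ≡ 0ℚ
  u-last = begin
    p ℚ.* ν (a C (2 ℕ.* suc n)) ℚ.* β ≡⟨ cong (λ x → p ℚ.* ν x ℚ.* β) (k>n⇒nCk≡0 a<2n+2) ⟩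
    p ℚ.* ν 0 ℚ.* β                   ≡⟨ cong (λ x → p ℚ.* x ℚ.* β) ν-0 ⟩
    p ℚ.* 0ℚ ℚ.* β                    ≡⟨ solve 2 (λ p β → p :* con 0ℚ :* β := con 0ℚ) refl p β ⟩
    0ℚ                                ∎
    where
    p = ι ((- (+ 1)) ^ suc n)
    β = beta (n ∸ n) (suc n)
    a<2n+2 : a ℕ.< 2 ℕ.* suc n
    a<2n+2 = subst (a ℕ.<_) (sym (ℕ.*-suc 2 n)) (s≤s a≤2n+1)

  combine : ∀ k → k ℕ.≤ n → alternatingTerm n a k ℚ.+ z k ≡ u k
  combine k k≤n = begin
    p ℚ.* v ℚ.* beta (n ∸ k) k ℚ.+ ι ((- (+ 1)) ^ suc k) ℚ.* v ℚ.* β′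
      ≡⟨ cong₂ (λ x y → p ℚ.* v ℚ.* x ℚ.+ y ℚ.* v ℚ.* β′) (beta-split (n ∸ k) k) (ι-*-minus-1 ((- (+ 1)) ^ k)) ⟩
    p ℚ.* v ℚ.* (β ℚ.+ β′) ℚ.+ ℚ.- p ℚ.* v ℚ.* β′
      ≡⟨ solve 4 (λ p v β β′ → p :* v :* (β :+ β′) :+ :- p :* v :* β′ := p :* v :* β) refl p v β β′ ⟩
    p ℚ.* v ℚ.* β
      ≡⟨ cong (λ j → p ℚ.* v ℚ.* beta j k) (ℕ.+-∸-assoc 1 k≤n) ⟨
    u k ∎
    where
    p = ι ((- (+ 1)) ^ k)
    v = ν (a C (2 ℕ.* k))
    β = beta (suc (n ∸ k)) k
    β′ = beta (n ∸ k) (suc k)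

  step : ∀ k → alternatingTerm (suc n) (2 ℕ.+ a) (suc k) ℚ.+ u (suc k) ≡ t (suc k) ℚ.+ t (suc k) ℚ.+ z k
  step k = linear-recurrence (ι ((- (+ 1)) ^ suc k)) (beta (n ∸ k) (suc k))
    (suc (suc a) C (2 ℕ.* suc k)) (a C (2 ℕ.* suc k)) (suc a C (2 ℕ.* suc k)) (a C (2 ℕ.* k))
    (second-difference-even a k)

sumTo-head : ∀ N (f : ℕ → ℚ) → (∀ k → f (suc k) ≡ 0ℚ) → sumTo N f ≡ f 0
sumTo-head zero f eq = ℚ.+-identityʳ (f 0)
sumTo-head (suc N) f eq = trans (sumTo-drop N f (eq N)) (sumTo-head N f eq)

alternatingSum-base : ∀ n a → a ℕ.≤ 1 → alternatingSum n a ≡ beta n 0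
alternatingSum-base n a a≤1 = begin
  alternatingSum n a         ≡⟨ sumTo-head n (alternatingTerm n a) vanishes ⟩
  ν 1 ℚ.* ν 1 ℚ.* beta n 0   ≡⟨ cong (λ x → x ℚ.* x ℚ.* beta n 0) ν-1 ⟩
  1ℚ ℚ.* 1ℚ ℚ.* beta n 0     ≡⟨ solve 1 (λ x → con 1ℚ :* con 1ℚ :* x := x) refl (beta n 0) ⟩
  beta n 0                   ∎
  where
  open ≡-Reasoning
  vanishes : ∀ k → alternatingTerm n a (suc k) ≡ 0ℚ
  vanishes k = begin
    p ℚ.* ν (a C (2 ℕ.* suc k)) ℚ.* β ≡⟨ cong (λ x → p ℚ.* ν x ℚ.* β) (k>n⇒nCk≡0 a<2k+2) ⟩
    p ℚ.* ν 0 ℚ.* β                   ≡⟨ cong (λ x → p ℚ.* x ℚ.* β) ν-0 ⟩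
    p ℚ.* 0ℚ ℚ.* β                    ≡⟨ solve 2 (λ p β → p :* con 0ℚ :* β := con 0ℚ) refl p β ⟩
    0ℚ                                ∎
    where
    p = ι ((- (+ 1)) ^ suc k)
    β = beta (n ∸ suc k) (suc k)
    a<2k+2 : a ℕ.< 2 ℕ.* suc k
    a<2k+2 = subst (a ℕ.<_) (sym (ℕ.*-suc 2 k)) (s≤s (ℕ.≤-trans a≤1 (s≤s z≤n)))

-- Agreement of the two expansions.

-- This is 2 ∫₀¹ x^(2n+1) dx = 1/(n + 1). The factor 2 is `chebyshev 0 0`, where the truncated
-- `0 ∸ 1` makes both binomials equal to 1.
moment-zero : ∀ n → moment 0 (suc (2 ℕ.* n)) ≡ beta n 0
moment-zero n = begin
  ν 1 ℚ.* ν 2 ℚ.* ρ (betaDen b 0) ℚ.+ 0ℚ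
    ≡⟨ cong₂ (λ x y → x ℚ.* ν 2 ℚ.* ρ y ℚ.+ 0ℚ) ν-1 double ⟩
  1ℚ ℚ.* ν 2 ℚ.* ρ (2 ℕ.* betaDen n 0) ℚ.+ 0ℚ
    ≡⟨ cong (λ x → 1ℚ ℚ.* ν 2 ℚ.* x ℚ.+ 0ℚ) (ρ-* 2 (betaDen n 0)) ⟩
  1ℚ ℚ.* ν 2 ℚ.* (ρ 2 ℚ.* beta n 0) ℚ.+ 0ℚ
    ≡⟨ solve 3 (λ x y z → con 1ℚ :* x :* (y :* z) :+ con 0ℚ := x :* y :* z) refl (ν 2) (ρ 2) (beta n 0) ⟩
  ν 2 ℚ.* ρ 2 ℚ.* beta n 0
    ≡⟨ cong (ℚ._* beta n 0) (ν-ρ 1) ⟩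
  1ℚ ℚ.* beta n 0
    ≡⟨ ℚ.*-identityˡ (beta n 0) ⟩
  beta n 0 ∎
  where
  open ≡-Reasoning
  b = suc (2 ℕ.* n)
  linear : ∀ n → suc (suc (2 ℕ.* n) ℕ.+ 0) ℕ.* 1 ≡ 2 ℕ.* (suc (n ℕ.+ 0) ℕ.* 1)
  linear = ℕ-Solver.solve-∀
  double : betaDen b 0 ≡ 2 ℕ.* betaDen n 0
  double = linear n

-- Since T_1 = x T_0, the extra factor x can be moved into x^b.
moment-one : ∀ b → moment 1 b ≡ moment 0 (suc b)
moment-one b = begin
  p ℚ.* ν 2 ℚ.* beta b 0 ℚ.+ (ι ((- (+ 2)) ^ 1) ℚ.* ν 1 ℚ.* β′ ℚ.+ 0ℚ)
    ≡⟨ cong₂ (λ x y → p ℚ.* ν 2 ℚ.* x ℚ.+ (y ℚ.* ν 1 ℚ.* β′ ℚ.+ 0ℚ)) (beta-split b 0) (ι-*-minus-2 (+ 1)) ⟩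
  p ℚ.* ν 2 ℚ.* (β ℚ.+ β′) ℚ.+ (ℚ.- (p ℚ.+ p) ℚ.* ν 1 ℚ.* β′ ℚ.+ 0ℚ)
    ≡⟨ cong (λ x → p ℚ.* x ℚ.* (β ℚ.+ β′) ℚ.+ (ℚ.- (p ℚ.+ p) ℚ.* ν 1 ℚ.* β′ ℚ.+ 0ℚ)) (ν-double 1) ⟩
  p ℚ.* (ν 1 ℚ.+ ν 1) ℚ.* (β ℚ.+ β′) ℚ.+ (ℚ.- (p ℚ.+ p) ℚ.* ν 1 ℚ.* β′ ℚ.+ 0ℚ)
    ≡⟨ solve 4 (λ p v β β′ → p :* (v :+ v) :* (β :+ β′) :+ (:- (p :+ p) :* v :* β′ :+ con 0ℚ)
                               := p :* (v :+ v) :* β :+ con 0ℚ) refl p (ν 1) β β′ ⟩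
  p ℚ.* (ν 1 ℚ.+ ν 1) ℚ.* β ℚ.+ 0ℚ
    ≡⟨ cong (λ x → p ℚ.* x ℚ.* β ℚ.+ 0ℚ) (ν-double 1) ⟨
  p ℚ.* ν 2 ℚ.* β ℚ.+ 0ℚ ∎
  where
  open ≡-Reasoning
  p = ν 1
  β = beta (suc b) 0
  β′ = beta b 1

-- Two-step induction on `a`. Passing to (a + 1, b + 1) from (a + 2, b) keeps the total and hence
-- `n`; passing to (a, b) lowers the total by 2 and `n` by 1.
moment≡alternatingSum : ∀ a b n → a ℕ.+ b ≡ suc (2 ℕ.* n) → moment a b ≡ alternatingSum n a
moment≡alternatingSum zero b n refl = trans (moment-zero n) (sym (alternatingSum-base n 0 z≤n))
moment≡alternatingSum (suc zero) b n refl =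
  trans (moment-one b) (trans (moment-zero n) (sym (alternatingSum-base n 1 ℕ.≤-refl)))
moment≡alternatingSum (suc (suc a)) b zero ()
moment≡alternatingSum (suc (suc a)) b (suc n) eq = ∙-cancelʳ (moment a b) _ _ (begin
  moment (suc (suc a)) b ℚ.+ moment a b
    ≡⟨ moment-recurrence a b ⟩
  moment (suc a) (suc b) ℚ.+ moment (suc a) (suc b)
    ≡⟨ cong (λ x → x ℚ.+ x) (moment≡alternatingSum (suc a) (suc b) (suc n) (trans (cong suc (ℕ.+-suc a b)) eq)) ⟩
  alternatingSum (suc n) (suc a) ℚ.+ alternatingSum (suc n) (suc a)
    ≡⟨ alternatingSum-recurrence n a (subst (a ℕ.≤_) a+b≡2n+1 (ℕ.m≤m+n a b)) ⟨
  alternatingSum (suc n) (suc (suc a)) ℚ.+ alternatingSum n a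
    ≡⟨ cong (alternatingSum (suc n) (suc (suc a)) ℚ.+_) (moment≡alternatingSum a b n a+b≡2n+1) ⟨
  alternatingSum (suc n) (suc (suc a)) ℚ.+ moment a b ∎)
  where
  open ≡-Reasoning
  a+b≡2n+1 : a ℕ.+ b ≡ suc (2 ℕ.* n)
  a+b≡2n+1 = ℕ.suc-injective (ℕ.suc-injective (trans eq (cong suc (ℕ.*-suc 2 n))))

-- From the moments to the summands of the theorem.

-- The left summand for a = n + m and b = n - m + 1: C(a + k, a - k) is reflected to C(a + k, 2k),
-- and the factor b + k + 1 merges with C(b + k, k) into `betaDen b k`.
leftTerm : ℕ → ℕ → ℕ → ℚ
leftTerm a b k = ((- (+ 2)) ^ k * + ((a ℕ.+ k) C (2 ℕ.* k))) ÷ℤ + ((a ℕ.+ k) ℕ.* betaDen b k)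

rightTerm : ℕ → ℤ → ℕ → ℚ
rightTerm n i k = (((- (+ 1)) ^ k) ÷ℤ + 1) ℚ.* (binom i (+ 2 * + k) ÷ℤ binom (+ n) (+ k))

rightSum : ℕ → ℤ → ℚ
rightSum n i = sumTo n (rightTerm n i)

leftTerm-scaled : ∀ a b k → ν (2 ℕ.* suc a) ℚ.* leftTerm (suc a) b k ≡ chebyshevTerm (suc a) b k
leftTerm-scaled a b k = begin
  ν (2 ℕ.* suc a) ℚ.* leftTerm (suc a) b k
    ≡⟨ cong (ν (2 ℕ.* suc a) ℚ.*_) (trans (÷-split _ _) (cong₂ ℚ._*_ (ι-* ((- (+ 2)) ^ k) (+ c)) (ρ-* s (betaDen b k)))) ⟩
  ν (2 ℕ.* suc a) ℚ.* (p ℚ.* ν c ℚ.* (ρ s ℚ.* β))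
    ≡⟨ solve 5 (λ x p c r β → x :* (p :* c :* (r :* β)) := p :* (x :* c) :* (r :* β)) refl (ν (2 ℕ.* suc a)) p (ν c) (ρ s) β ⟩
  p ℚ.* (ν (2 ℕ.* suc a) ℚ.* ν c) ℚ.* (ρ s ℚ.* β)
    ≡⟨ cong (λ x → p ℚ.* x ℚ.* (ρ s ℚ.* β)) (trans (sym (ν-* s e)) (trans (cong ν (chebyshev-closed a k)) (ν-* (2 ℕ.* suc a) c))) ⟨
  p ℚ.* (ν s ℚ.* ν e) ℚ.* (ρ s ℚ.* β)
    ≡⟨ solve 5 (λ s p e r β → p :* (s :* e) :* (r :* β) := s :* r :* (p :* e :* β)) refl (ν s) p (ν e) (ρ s) β ⟩
  ν s ℚ.* ρ s ℚ.* (p ℚ.* ν e ℚ.* β)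
    ≡⟨ cong (ℚ._* (p ℚ.* ν e ℚ.* β)) (ν-ρ (a ℕ.+ k)) ⟩
  1ℚ ℚ.* (p ℚ.* ν e ℚ.* β)
    ≡⟨ ℚ.*-identityˡ _ ⟩
  chebyshevTerm (suc a) b k ∎
  where
  open ≡-Reasoning
  p = ι ((- (+ 2)) ^ k)
  s = suc a ℕ.+ k
  c = s C (2 ℕ.* k)
  e = chebyshev (suc a) k
  β = beta b k

-- As (n - k) + k = n, the beta denominator is (n + 1) C(n, k), and 1/(n + 1) leaves the sum.
alternatingSum≡rightSum : ∀ n a → alternatingSum n a ≡ ρ (suc n) ℚ.* rightSum n (+ a)
alternatingSum≡rightSum n a = trans (sumTo-cong n term) (sumTo-* n (ρ (suc n)) (rightTerm n (+ a)))
  where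
  open ≡-Reasoning
  term : ∀ k → k ℕ.≤ n → alternatingTerm n a k ≡ ρ (suc n) ℚ.* rightTerm n (+ a) k
  term k k≤n = begin
    p ℚ.* ν c ℚ.* ρ (suc (n ∸ k ℕ.+ k) ℕ.* ((n ∸ k ℕ.+ k) C k))
      ≡⟨ cong (λ m → p ℚ.* ν c ℚ.* ρ (suc m ℕ.* (m C k))) (ℕ.m∸n+n≡m k≤n) ⟩
    p ℚ.* ν c ℚ.* ρ (suc n ℕ.* (n C k))
      ≡⟨ cong (p ℚ.* ν c ℚ.*_) (ρ-* (suc n) (n C k)) ⟩
    p ℚ.* ν c ℚ.* (ρ (suc n) ℚ.* ρ (n C k))
      ≡⟨ solve 4 (λ p c r s → p :* c :* (r :* s) := r :* (p :* (c :* s))) refl p (ν c) (ρ (suc n)) (ρ (n C k)) ⟩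
    ρ (suc n) ℚ.* (p ℚ.* (ν c ℚ.* ρ (n C k)))
      ≡⟨ cong₂ (λ x y → ρ (suc n) ℚ.* (x ℚ.* y)) (ι-÷ ((- (+ 1)) ^ k)) (÷-split (+ c) (n C k)) ⟨
    ρ (suc n) ℚ.* ((((- (+ 1)) ^ k) ÷ℤ + 1) ℚ.* (+ c ÷ℤ + (n C k)))
      ≡⟨ cong (λ i → ρ (suc n) ℚ.* ((((- (+ 1)) ^ k) ÷ℤ + 1) ℚ.* (binom (+ a) i ÷ℤ + (n C k)))) (ℤ.pos-* 2 k) ⟩
    ρ (suc n) ℚ.* rightTerm n (+ a) k ∎
    where
    p = ι ((- (+ 1)) ^ k)
    c = a C (2 ℕ.* k)

sum-leftTerm : ∀ a b n → 1 ℕ.≤ a → a ℕ.+ b ≡ suc (2 ℕ.* n) →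
  sumTo a (leftTerm a b) ≡ ρ (2 ℕ.* suc n ℕ.* a) ℚ.* rightSum n (+ a)
-- The argument of `ν-cancelˡ` is the predecessor of `2 * suc a`, in the form to which that product
-- reduces.
sum-leftTerm (suc a) b n _ eq = ν-cancelˡ (a ℕ.+ suc (a ℕ.+ 0)) (begin
  ν d ℚ.* sumTo (suc a) (leftTerm (suc a) b)
    ≡⟨ sumTo-* (suc a) (ν d) (leftTerm (suc a) b) ⟨
  sumTo (suc a) (λ k → ν d ℚ.* leftTerm (suc a) b k)
    ≡⟨ sumTo-cong (suc a) (λ k _ → leftTerm-scaled a b k) ⟩
  moment (suc a) b
    ≡⟨ moment≡alternatingSum (suc a) b n eq ⟩
  alternatingSum n (suc a)
    ≡⟨ alternatingSum≡rightSum n (suc a) ⟩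
  ρ (suc n) ℚ.* R
    ≡⟨ ℚ.*-identityˡ _ ⟨
  1ℚ ℚ.* (ρ (suc n) ℚ.* R)
    ≡⟨ cong (ℚ._* (ρ (suc n) ℚ.* R)) (ν-ρ (a ℕ.+ suc (a ℕ.+ 0))) ⟨
  ν d ℚ.* ρ d ℚ.* (ρ (suc n) ℚ.* R)
    ≡⟨ solve 4 (λ x y z w → x :* y :* (z :* w) := x :* (y :* z :* w)) refl (ν d) (ρ d) (ρ (suc n)) R ⟩
  ν d ℚ.* (ρ d ℚ.* ρ (suc n) ℚ.* R)
    ≡⟨ cong (λ x → ν d ℚ.* (x ℚ.* R)) (trans (sym (ρ-* d (suc n))) (cong ρ (swap (suc a) (suc n)))) ⟩
  ν d ℚ.* (ρ (2 ℕ.* suc n ℕ.* suc a) ℚ.* R) ∎)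
  where
  open ≡-Reasoning
  d = 2 ℕ.* suc a
  R = rightSum n (+ suc a)
  swap : ∀ x y → 2 ℕ.* x ℕ.* y ≡ 2 ℕ.* y ℕ.* x
  swap = ℕ-Solver.solve-∀

-- Passage from integer expressions to natural numbers.

+-sub : ∀ {m n} → n ℕ.≤ m → + m - + n ≡ + (m ∸ n)
+-sub {m} {n} n≤m = trans (ℤ.m-n≡m⊖n m n) (ℤ.⊖-≥ n≤m)

C-reflect : ∀ {a k} → k ℕ.≤ a → (a ℕ.+ k) C (a ∸ k) ≡ (a ℕ.+ k) C (2 ℕ.* k)
C-reflect {a} {k} k≤a = trans (nCk≡nC[n∸k] (ℕ.≤-trans (ℕ.m∸n≤m a k) (ℕ.m≤m+n a k)))
  (cong ((a ℕ.+ k) C_) (begin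
    a ℕ.+ k ∸ (a ∸ k)               ≡⟨ cong (_∸ (a ∸ k)) (cong (ℕ._+ k) (ℕ.m∸n+n≡m k≤a)) ⟨
    a ∸ k ℕ.+ k ℕ.+ k ∸ (a ∸ k)     ≡⟨ cong (_∸ (a ∸ k)) (ℕ.+-assoc (a ∸ k) k k) ⟩
    a ∸ k ℕ.+ (k ℕ.+ k) ∸ (a ∸ k)   ≡⟨ ℕ.m+n∸m≡n (a ∸ k) (k ℕ.+ k) ⟩
    k ℕ.+ k                         ≡⟨ cong (k ℕ.+_) (ℕ.+-identityʳ k) ⟨
    2 ℕ.* k                         ∎))
  where open ≡-Reasoning

÷-*-C : ∀ p d {a k e} → k ℕ.≤ a →
  (p ÷ℤ + d) ℚ.* (+ ((a ℕ.+ k) C (a ∸ k)) ÷ℤ + e) ≡ (p * + ((a ℕ.+ k) C (2 ℕ.* k))) ÷ℤ + (d ℕ.* e)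
÷-*-C p d {a} {k} {e} k≤a = trans (÷-* p (+ ((a ℕ.+ k) C (a ∸ k))) d e)
  (cong (λ c → (p * + c) ÷ℤ + (d ℕ.* e)) (C-reflect k≤a))

-- The integer expressions enter as variables with equations, so that matching on `refl` replaces
-- them by casts of naturals, on which `binom` computes.
leftTerm-ℤ : ∀ a b k {x y z w} → k ℕ.≤ a →
  x ≡ + (a ℕ.+ k) → y ≡ + suc (b ℕ.+ k) → z ≡ + (a ∸ k) → w ≡ + (b ℕ.+ k) →
  ((- (+ 2)) ^ k ÷ℤ (x * y)) ℚ.* (binom x z ÷ℤ binom w (+ k)) ≡ leftTerm a b k
leftTerm-ℤ a b k k≤a refl refl refl refl = begin
  (p ÷ℤ (+ s * + suc (b ℕ.+ k))) ℚ.* (+ (s C (a ∸ k)) ÷ℤ + c)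
    ≡⟨ cong (λ d → (p ÷ℤ d) ℚ.* (+ (s C (a ∸ k)) ÷ℤ + c)) (ℤ.pos-* s (suc (b ℕ.+ k))) ⟨
  (p ÷ℤ + (s ℕ.* suc (b ℕ.+ k))) ℚ.* (+ (s C (a ∸ k)) ÷ℤ + c)
    ≡⟨ ÷-*-C p (s ℕ.* suc (b ℕ.+ k)) k≤a ⟩
  (p * + (s C (2 ℕ.* k))) ÷ℤ + (s ℕ.* suc (b ℕ.+ k) ℕ.* c)
    ≡⟨ cong (λ d → (p * + (s C (2 ℕ.* k))) ÷ℤ + d) (ℕ.*-assoc s (suc (b ℕ.+ k)) c) ⟩
  leftTerm a b k ∎
  where
  open ≡-Reasoning
  p = (- (+ 2)) ^ k
  s = a ℕ.+ k
  c = (b ℕ.+ k) C k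

general-identity : ∀ n m a b → 1 ℕ.≤ a → + n + m ≡ + a → + n - m + + 1 ≡ + b →
  ∑[ k ≤ ∣ + n + m ∣ ]
    (((- (+ 2)) ^ k ÷ℤ ((+ n + m + + k) * (+ n - m + + k + + 2)))
      ℚ.* (binom (+ n + m + + k) (+ n + m - + k) ÷ℤ binom (+ n - m + + k + + 1) (+ k)))
  ≡ (+ 1 ÷ℤ (+ 2 * (+ n + + 1) * (+ n + m))) ℚ.* rightSum n (+ n + m)
general-identity n m a b 1≤a n+m≡a n-m+1≡b = begin
  sumTo ∣ + n + m ∣ term
    ≡⟨ cong (λ i → sumTo ∣ i ∣ term) n+m≡a ⟩
  sumTo a term
    ≡⟨ sumTo-cong a (λ k k≤a → leftTerm-ℤ a b k k≤a
         (cong (_+ + k) n+m≡a)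
         -- The factor n - m + k + 2 is `suc (b + k)`, the leading factor of `betaDen b k`.
         (trans (shift₂ (+ n) m (+ k)) (trans (cong (λ i → + 1 + (i + + k)) n-m+1≡b) refl))
         (trans (cong (_- + k) n+m≡a) (+-sub k≤a))
         (trans (shift₁ (+ n) m (+ k)) (cong (_+ + k) n-m+1≡b))) ⟩
  sumTo a (leftTerm a b)
    ≡⟨ sum-leftTerm a b n 1≤a (ℤ.+-injective a+b≡2n+1) ⟩
  ρ (2 ℕ.* suc n ℕ.* a) ℚ.* rightSum n (+ a)
    ≡⟨ cong (ℚ._* rightSum n (+ a)) (ρ-÷ (2 ℕ.* suc n ℕ.* a)) ⟨
  (+ 1 ÷ℤ + (2 ℕ.* suc n ℕ.* a)) ℚ.* rightSum n (+ a)
    ≡⟨ cong (λ i → (+ 1 ÷ℤ i) ℚ.* rightSum n (+ a)) (trans (cong (λ j → + (2 ℕ.* j ℕ.* a)) (ℕ.+-comm 1 n))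
         (trans (ℤ.pos-* (2 ℕ.* (n ℕ.+ 1)) a) (cong (_* + a) (ℤ.pos-* 2 (n ℕ.+ 1))))) ⟩
  (+ 1 ÷ℤ (+ 2 * (+ n + + 1) * + a)) ℚ.* rightSum n (+ a)
    ≡⟨ cong (λ i → (+ 1 ÷ℤ (+ 2 * (+ n + + 1) * i)) ℚ.* rightSum n i) n+m≡a ⟨
  (+ 1 ÷ℤ (+ 2 * (+ n + + 1) * (+ n + m))) ℚ.* rightSum n (+ n + m) ∎
  where
  open ≡-Reasoning
  term : ℕ → ℚ
  term k = ((- (+ 2)) ^ k ÷ℤ ((+ n + m + + k) * (+ n - m + + k + + 2)))
    ℚ.* (binom (+ n + m + + k) (+ n + m - + k) ÷ℤ binom (+ n - m + + k + + 1) (+ k))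
  shift₁ : ∀ n m k → n - m + k + + 1 ≡ n - m + + 1 + k
  shift₁ = ℤ-Solver.solve-∀
  shift₂ : ∀ n m k → n - m + k + + 2 ≡ + 1 + (n - m + + 1 + k)
  shift₂ = ℤ-Solver.solve-∀
  total : ∀ n m → (n + m) + (n - m + + 1) ≡ + 1 + + 2 * n
  total = ℤ-Solver.solve-∀
  a+b≡2n+1 : + a + + b ≡ + suc (2 ℕ.* n)
  a+b≡2n+1 = begin
    + a + + b                       ≡⟨ cong₂ _+_ n+m≡a n-m+1≡b ⟨
    (+ n + m) + (+ n - m + + 1)     ≡⟨ total (+ n) m ⟩
    + 1 + + 2 * + n                 ≡⟨ cong (λ i → + 1 + i) (ℤ.pos-* 2 n) ⟨
    + suc (2 ℕ.* n)                 ∎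

-- The general identity and the cases m = 0 and m = n.

pos-witness : ∀ {i} → + 0 < i → 1 ℕ.≤ ∣ i ∣ × i ≡ + ∣ i ∣
pos-witness {+ suc n} _ = s≤s z≤n , refl
pos-witness {+ zero} (_<_.+<+ ())

theorem26 :
  ((n : ℕ) (m : ℤ) → + 0 < + n + m → + n + m ≤ + 2 * + n + + 1 →
    ∑[ k ≤ ∣ + n + m ∣ ]
      (((- (+ 2)) ^ k ÷ℤ ((+ n + m + + k) * (+ n - m + + k + + 2)))
        ℚ.* (binom (+ n + m + + k) (+ n + m - + k) ÷ℤ binom (+ n - m + + k + + 1) (+ k)))
    ≡ (+ 1 ÷ℤ (+ 2 * (+ n + + 1) * (+ n + m)))
        ℚ.* ∑[ k ≤ n ]
              ((((- (+ 1)) ^ k) ÷ℤ + 1) ℚ.* (binom (+ n + m) (+ 2 * + k) ÷ℤ binom (+ n) (+ k))))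
  × ((n : ℕ) → 1 ℕ.≤ n →
    ∑[ k ≤ n ]
      (((- (+ 2)) ^ k ÷ℤ ((+ n + + k) * (+ n + + k + + 1) * (+ n + + k + + 2)))
        ℚ.* (binom (+ n + + k) (+ n - + k) ÷ℤ binom (+ n + + k) (+ k)))
    ≡ (+ 1 ÷ℤ (+ 2 * + n * (+ n + + 1) ^ 2))
        ℚ.* ∑[ k ≤ n ]
              ((((- (+ 1)) ^ k) ÷ℤ + 1) ℚ.* (binom (+ n) (+ 2 * + k) ÷ℤ binom (+ n) (+ k))))
  × ((n : ℕ) → 1 ℕ.≤ n →
    ∑[ k ≤ 2 ℕ.* n ]
      (((- (+ 2)) ^ k ÷ℤ ((+ 2 * + n + + k) * (+ k + + 1) * (+ k + + 2)))
        ℚ.* (binom (+ 2 * + n + + k) (+ 2 * + n - + k) ÷ℤ + 1))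
    ≡ (+ 1 ÷ℤ (+ 4 * + n * (+ n + + 1)))
        ℚ.* ∑[ k ≤ n ]
              ((((- (+ 1)) ^ k) ÷ℤ + 1) ℚ.* (binom (+ 2 * + n) (+ 2 * + k) ÷ℤ binom (+ n) (+ k))))
theorem26 = general , zero-shift , equal-shift
  where
  open ≡-Reasoning

  general : ∀ n m → + 0 < + n + m → + n + m ≤ + 2 * + n + + 1 → _
  general n m 0<n+m n+m≤2n+1 with 1≤a , n+m≡a ← pos-witness 0<n+m =
    -- The upper bound on n + m says exactly that n - m + 1 is nonnegative, so its absolute value
    -- can serve as `b`.
    general-identity n m ∣ + n + m ∣ ∣ + n - m + + 1 ∣ 1≤a n+m≡a
      (sym (ℤ.0≤i⇒+∣i∣≡i (subst (+ 0 ≤_) (complement (+ n) m) (ℤ.i≤j⇒0≤j-i n+m≤2n+1))))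
    where
    complement : ∀ n m → (+ 2 * n + + 1) - (n + m) ≡ n - m + + 1
    complement = ℤ-Solver.solve-∀

  zero-shift : ∀ n → 1 ℕ.≤ n → _
  zero-shift n 1≤n = begin
    sumTo n term
      -- Here m = 0 and `b` is `suc n`. As (n + 1) C(n + k + 1, k) = (n + k + 1) C(n + k, k), each
      -- summand is the general one divided by n + 1.
      ≡⟨ sumTo-cong n scaled ⟩
    sumTo n (λ k → ρ (suc n) ℚ.* leftTerm n (suc n) k)
      ≡⟨ sumTo-* n (ρ (suc n)) (leftTerm n (suc n)) ⟩
    ρ (suc n) ℚ.* sumTo n (leftTerm n (suc n))
      ≡⟨ cong (ρ (suc n) ℚ.*_) (sum-leftTerm n (suc n) n 1≤n (double n)) ⟩
    ρ (suc n) ℚ.* (ρ (2 ℕ.* suc n ℕ.* n) ℚ.* R)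
      ≡⟨ ℚ.*-assoc (ρ (suc n)) _ R ⟨
    ρ (suc n) ℚ.* ρ (2 ℕ.* suc n ℕ.* n) ℚ.* R
      ≡⟨ cong (ℚ._* R) (trans (ρ-÷ _) (ρ-* (suc n) (2 ℕ.* suc n ℕ.* n))) ⟨
    (+ 1 ÷ℤ + (suc n ℕ.* (2 ℕ.* suc n ℕ.* n))) ℚ.* R
      ≡⟨ cong (λ i → (+ 1 ÷ℤ i) ℚ.* R) denominator ⟩
    (+ 1 ÷ℤ (+ 2 * + n * (+ n + + 1) ^ 2)) ℚ.* R ∎
    where
    R = rightSum n (+ n)
    term : ℕ → ℚ
    term k = ((- (+ 2)) ^ k ÷ℤ ((+ n + + k) * (+ n + + k + + 1) * (+ n + + k + + 2)))
      ℚ.* (binom (+ n + + k) (+ n - + k) ÷ℤ binom (+ n + + k) (+ k))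
    double : ∀ n → n ℕ.+ suc n ≡ suc (2 ℕ.* n)
    double = ℕ-Solver.solve-∀

    denominator : + (suc n ℕ.* (2 ℕ.* suc n ℕ.* n)) ≡ + 2 * + n * (+ n + + 1) ^ 2
    denominator = begin
      + (suc n ℕ.* (2 ℕ.* suc n ℕ.* n))       ≡⟨ ℤ.pos-* (suc n) _ ⟩
      + suc n * + (2 ℕ.* suc n ℕ.* n)         ≡⟨ cong (+ suc n *_) (trans (ℤ.pos-* (2 ℕ.* suc n) n) (cong (_* + n) (ℤ.pos-* 2 (suc n)))) ⟩
      (+ 1 + + n) * (+ 2 * (+ 1 + + n) * + n) ≡⟨ expand (+ n) ⟩
      + 2 * + n * (+ n + + 1) ^ 2             ∎
      where
      expand : ∀ n → (+ 1 + n) * (+ 2 * (+ 1 + n) * n) ≡ + 2 * n * ((n + + 1) * ((n + + 1) * + 1))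
      expand = ℤ-Solver.solve-∀

    scaled : ∀ k → k ℕ.≤ n → term k ≡ ρ (suc n) ℚ.* leftTerm n (suc n) k
    scaled k k≤n = begin
      term k
        ≡⟨ cong₂ (λ i j → (p ÷ℤ i) ℚ.* (binom (+ s) j ÷ℤ + c)) denominator′ (+-sub k≤n) ⟩
      (p ÷ℤ + (s ℕ.* (s ℕ.+ 1) ℕ.* (s ℕ.+ 2))) ℚ.* (+ (s C (n ∸ k)) ÷ℤ + c)
        ≡⟨ ÷-*-C p (s ℕ.* (s ℕ.+ 1) ℕ.* (s ℕ.+ 2)) k≤n ⟩
      x ÷ℤ + (s ℕ.* (s ℕ.+ 1) ℕ.* (s ℕ.+ 2) ℕ.* c)
        ≡⟨ cong₂ (λ y d → y ÷ℤ + d) (sym (ℤ.*-identityˡ x)) rebalance ⟩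
      (+ 1 * x) ÷ℤ + (suc n ℕ.* (s ℕ.* betaDen (suc n) k))
        ≡⟨ ÷-* (+ 1) x (suc n) (s ℕ.* betaDen (suc n) k) ⟨
      (+ 1 ÷ℤ + suc n) ℚ.* leftTerm n (suc n) k
        ≡⟨ cong (ℚ._* leftTerm n (suc n) k) (ρ-÷ (suc n)) ⟩
      ρ (suc n) ℚ.* leftTerm n (suc n) k ∎
      where
      p = (- (+ 2)) ^ k
      s = n ℕ.+ k
      c = s C k
      x = p * + (s C (2 ℕ.* k))
      denominator′ : + s * + (s ℕ.+ 1) * + (s ℕ.+ 2) ≡ + (s ℕ.* (s ℕ.+ 1) ℕ.* (s ℕ.+ 2))
      denominator′ = sym (trans (ℤ.pos-* (s ℕ.* (s ℕ.+ 1)) (s ℕ.+ 2)) (cong (_* + (s ℕ.+ 2)) (ℤ.pos-* s (s ℕ.+ 1))))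
      rebalance : s ℕ.* (s ℕ.+ 1) ℕ.* (s ℕ.+ 2) ℕ.* c ≡ suc n ℕ.* (s ℕ.* betaDen (suc n) k)
      rebalance = begin
        s ℕ.* (s ℕ.+ 1) ℕ.* (s ℕ.+ 2) ℕ.* c        ≡⟨ collect s c ⟩
        s ℕ.* (suc (suc s) ℕ.* (suc s ℕ.* c))      ≡⟨ cong (s ℕ.*_) (betaDen-sucˡ n k) ⟨
        s ℕ.* (suc n ℕ.* betaDen (suc n) k)        ≡⟨ x∙yz≈y∙xz s (suc n) (betaDen (suc n) k) ⟩
        suc n ℕ.* (s ℕ.* betaDen (suc n) k)        ∎
        where
        collect : ∀ s c → s ℕ.* (s ℕ.+ 1) ℕ.* (s ℕ.+ 2) ℕ.* c ≡ s ℕ.* (suc (suc s) ℕ.* (suc s ℕ.* c))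
        collect = ℕ-Solver.solve-∀

  equal-shift : ∀ n → 1 ℕ.≤ n → _
  equal-shift n 1≤n = begin
    sumTo a term
      -- Here m = n and `b` is 1. As C(k + 1, k) = k + 1, `betaDen 1 k` is (k + 1)(k + 2).
      ≡⟨ sumTo-cong a unscaled ⟩
    sumTo a (leftTerm a 1)
      ≡⟨ sum-leftTerm a 1 n (ℕ.≤-trans 1≤n (ℕ.m≤m+n n _)) (ℕ.+-comm a 1) ⟩
    ρ (2 ℕ.* suc n ℕ.* a) ℚ.* rightSum n (+ a)
      ≡⟨ cong (ℚ._* rightSum n (+ a)) (ρ-÷ (2 ℕ.* suc n ℕ.* a)) ⟨
    (+ 1 ÷ℤ + (2 ℕ.* suc n ℕ.* a)) ℚ.* rightSum n (+ a)
      ≡⟨ cong₂ (λ i j → (+ 1 ÷ℤ i) ℚ.* rightSum n j) denominator (ℤ.pos-* 2 n) ⟩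
    (+ 1 ÷ℤ (+ 4 * + n * (+ n + + 1))) ℚ.* rightSum n (+ 2 * + n) ∎
    where
    a = 2 ℕ.* n
    term : ℕ → ℚ
    term k = ((- (+ 2)) ^ k ÷ℤ ((+ 2 * + n + + k) * (+ k + + 1) * (+ k + + 2)))
      ℚ.* (binom (+ 2 * + n + + k) (+ 2 * + n - + k) ÷ℤ + 1)

    denominator : + (2 ℕ.* suc n ℕ.* a) ≡ + 4 * + n * (+ n + + 1)
    denominator = begin
      + (2 ℕ.* suc n ℕ.* (2 ℕ.* n))      ≡⟨ cong +_ (expand n) ⟩
      + (4 ℕ.* n ℕ.* (n ℕ.+ 1))          ≡⟨ ℤ.pos-* (4 ℕ.* n) (n ℕ.+ 1) ⟩
      + (4 ℕ.* n) * (+ n + + 1)          ≡⟨ cong (_* (+ n + + 1)) (ℤ.pos-* 4 n) ⟩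
      + 4 * + n * (+ n + + 1)            ∎
      where
      expand : ∀ n → 2 ℕ.* suc n ℕ.* (2 ℕ.* n) ≡ 4 ℕ.* n ℕ.* (n ℕ.+ 1)
      expand = ℕ-Solver.solve-∀

    unscaled : ∀ k → k ℕ.≤ a → term k ≡ leftTerm a 1 k
    unscaled k k≤a = begin
      term k
        ≡⟨ cong (λ i → (p ÷ℤ ((i + + k) * (+ k + + 1) * (+ k + + 2))) ℚ.* (binom (i + + k) (i - + k) ÷ℤ + 1)) (ℤ.pos-* 2 n) ⟨
      (p ÷ℤ (+ s * + (k ℕ.+ 1) * + (k ℕ.+ 2))) ℚ.* (binom (+ s) (+ a - + k) ÷ℤ + 1)
        ≡⟨ cong₂ (λ i j → (p ÷ℤ i) ℚ.* (binom (+ s) j ÷ℤ + 1)) denominator′ (+-sub k≤a) ⟩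
      (p ÷ℤ + (s ℕ.* (k ℕ.+ 1) ℕ.* (k ℕ.+ 2))) ℚ.* (+ (s C (a ∸ k)) ÷ℤ + 1)
        ≡⟨ ÷-*-C p (s ℕ.* (k ℕ.+ 1) ℕ.* (k ℕ.+ 2)) k≤a ⟩
      x ÷ℤ + (s ℕ.* (k ℕ.+ 1) ℕ.* (k ℕ.+ 2) ℕ.* 1)
        ≡⟨ cong (λ d → x ÷ℤ + d) (collect s k) ⟩
      x ÷ℤ + (s ℕ.* (suc (1 ℕ.+ k) ℕ.* (1 ℕ.+ k)))
        ≡⟨ cong (λ c → x ÷ℤ + (s ℕ.* (suc (1 ℕ.+ k) ℕ.* c))) (trans (symmetric 1 k) (nC1≡n (1 ℕ.+ k))) ⟨
      leftTerm a 1 k ∎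
      where
      p = (- (+ 2)) ^ k
      s = a ℕ.+ k
      x = p * + (s C (2 ℕ.* k))
      denominator′ : + s * + (k ℕ.+ 1) * + (k ℕ.+ 2) ≡ + (s ℕ.* (k ℕ.+ 1) ℕ.* (k ℕ.+ 2))
      denominator′ = sym (trans (ℤ.pos-* (s ℕ.* (k ℕ.+ 1)) (k ℕ.+ 2)) (cong (_* + (k ℕ.+ 2)) (ℤ.pos-* s (k ℕ.+ 1))))
      collect : ∀ s k → s ℕ.* (k ℕ.+ 1) ℕ.* (k ℕ.+ 2) ℕ.* 1 ≡ s ℕ.* (suc (1 ℕ.+ k) ℕ.* (1 ℕ.+ k))
      collect = ℕ-Solver.solve-∀
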